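{- Let $k\ge 2$ and let $G=(V,E,w)$ be a $k$-colorable graph with positive vertex weights that is a $(k-1)$-stable instance of \texttt{MIS}. Then every optimal solution $x$ of the standard LP relaxation of \texttt{MIS} for $G$ that is half-integral ($x_u\in\{0,\tfrac12,1\}$ for all $u$) is integral, i.e. $x_u\in\{0,1\}$ for all $u\in V$ (and hence is the indicator vector of the maximum weight independent set).
   Context: \texttt{MIS}: given a graph $G=(V,E)$ with weights $w:V\to\mathbb{R}_{>0}$, find an independent set maximizing $w(I)=\sum_{u\in I}w_u$. The standard LP relaxation: maximize $\sum_{u\in V}w_ux_u$ subject to $x_u+x_v\le1$ for $(u,v)\in E$, $x_u\in[0,1]$ for $u\in V$ (it is known to always have a half-integral optimal solution). For $\gamma\ge1$, a $\gamma$-perturbation of $w$ is any $w':V\to\mathbb{R}$ with $w_u\le w'_u\le\gamma w_u$ for all $u$. The instance $G=(V,E,w)$ is $\gamma$-stable if it has a unique maximum weight independent set $I^*$ and $I^*$ remains the unique maximum weight independent set of $(V,E,w')$ for every $\gamma$-perturbation $w'$ of $w$. -}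

module Defs where

open import Level using (Level; _⊔_; suc; 0ℓ)
open import Data.Bool using (if_then_else_)
open import Data.Nat using (ℕ)
open import Data.Fin using (Fin)
open import Data.Fin.Subset using (Subset; _∈_)
open import Data.Product using (_×_; _,_; proj₁; proj₂; Σ; ∃)
open import Data.Sum using (_⊎_; inj₁; inj₂)
open import Data.Vec using (lookup)
open import Function.Bundles using (_⇔_; module Equivalence)
open import Relation.Nullary using (¬_)
open import Relation.Binary.Core using (Rel)
open import Relation.Binary.Definitions using (Symmetric; Irreflexive)
open import Relation.Binary.Structures using (IsStrictPartialOrder)
open import Relation.Binary.PropositionalEquality using (_≡_; _≢_)
open import Algebra.Apartness.Bundles using (HeytingField)
open import Algebra.Bundles using (CommutativeRing)
import Algebra.Properties.CommutativeMonoid.Sum as Sum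
import Algebra.Definitions.RawMonoid as RawMonoidDefs
import Relation.Binary.Reasoning.Setoid as SetoidReasoning

-- The standard library has no real numbers, so the scalars range over all
-- ordered fields.  The order is neither decidable nor total by assumption:
-- with excluded middle these are exactly the linearly ordered fields (ℝ among
-- them), and the constructive Cauchy and Dedekind reals are models as well.
record OrderedField c ℓ₁ ℓ₂ ℓ₃ : Set (suc (c ⊔ ℓ₁ ⊔ ℓ₂ ⊔ ℓ₃)) where
  infix 4 _<_ _≤_
  field
    heytingField : HeytingField c ℓ₁ ℓ₂

  open HeytingField heytingField public

  field
    _<_                  : Rel Carrier ℓ₃
    isStrictPartialOrder : IsStrictPartialOrder _≈_ _<_
    #⇔<⊎>                : ∀ {x y} → x # y ⇔ (x < y ⊎ y < x)
    0<1                  : 0# < 1#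
    +-monoˡ-<            : ∀ {x y} z → x < y → x + z < y + z
    *-pos                : ∀ {x y} → 0# < x → 0# < y → 0# < x * y

  open IsStrictPartialOrder isStrictPartialOrder public
    using (<-resp-≈; <-respʳ-≈; <-respˡ-≈)
    renaming (trans to <-trans; irrefl to <-irrefl)

  _≤_ : Rel Carrier ℓ₃
  x ≤ y = ¬ (y < x)

  commutativeRing : CommutativeRing c ℓ₁
  commutativeRing = record { isCommutativeRing = isCommutativeRing }

  open CommutativeRing commutativeRing public
    using (+-commutativeMonoid; +-rawMonoid)

  fromℕ : ℕ → Carrier
  fromℕ m = RawMonoidDefs._×_ +-rawMonoid m 1#

  ∑ : ∀ {n} → (Fin n → Carrier) → Carrier
  ∑ = Sum.sum +-commutativeMonoid

  0<2 : 0# < 1# + 1#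
  0<2 = <-trans 0<1 (<-respˡ-≈ (+-identityˡ 1#) (+-monoˡ-< 1# 0<1))

  2#0 : (1# + 1#) # 0#
  2#0 = Equivalence.from #⇔<⊎> (inj₂ 0<2)

  -- The inverse that the library supplies is that of (1 + 1) - 0.
  ½ : Carrier
  ½ = proj₁ (#⇒invertible 2#0)

  ½+½≈1 : ½ + ½ ≈ 1#
  ½+½≈1 = begin
    ½ + ½                       ≈⟨ +-cong (*-identityʳ ½) (*-identityʳ ½) ⟨
    ½ * 1# + ½ * 1#             ≈⟨ distribˡ ½ 1# 1# ⟨
    ½ * (1# + 1#)               ≈⟨ *-congˡ (+-identityʳ (1# + 1#)) ⟨
    ½ * (1# + 1# + 0#)          ≈⟨ *-congˡ (+-congˡ -0≈0) ⟨
    ½ * (1# + 1# - 0#)          ≈⟨ proj₁ (proj₂ (#⇒invertible 2#0)) ⟩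
    1#                          ∎
    where
    open SetoidReasoning (CommutativeRing.setoid commutativeRing)
    -0≈0 : - 0# ≈ 0#
    -0≈0 = trans (sym (+-identityˡ (- 0#))) (-‿inverseʳ 0#)

record Graph (n : ℕ) : Set₁ where
  infix 4 _~_
  field
    _~_      : Rel (Fin n) 0ℓ
    ~-sym    : Symmetric _~_
    ~-irrefl : Irreflexive _≡_ _~_

module _ {n : ℕ} (G : Graph n) where
  open Graph G

  Independent : Subset n → Set
  Independent I = ∀ u v → u ∈ I → v ∈ I → ¬ (u ~ v)

  Colorable : ℕ → Set
  Colorable k = Σ (Fin n → Fin k) λ col → ∀ u v → u ~ v → col u ≢ col v

module MIS {c ℓ₁ ℓ₂ ℓ₃ : Level} (F : OrderedField c ℓ₁ ℓ₂ ℓ₃)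
           {n : ℕ} (G : Graph n) where
  open OrderedField F
  open Graph G

  weight : (Fin n → Carrier) → Subset n → Carrier
  weight w I = ∑ λ u → if lookup I u then w u else 0#

  IsMaximum : (Fin n → Carrier) → Subset n → Set ℓ₃
  IsMaximum w I =
    Independent G I × (∀ J → Independent G J → weight w J ≤ weight w I)

  IsUniqueMaximum : (Fin n → Carrier) → Subset n → Set ℓ₃
  IsUniqueMaximum w I = IsMaximum w I × (∀ J → IsMaximum w J → J ≡ I)

  IsPerturbation : Carrier → (w w′ : Fin n → Carrier) → Set ℓ₃
  IsPerturbation γ w w′ = ∀ u → w u ≤ w′ u × w′ u ≤ γ * w u

  Stable : Carrier → (Fin n → Carrier) → Set (c ⊔ ℓ₃)
  Stable γ w = ∃ λ I* →
    IsUniqueMaximum w I* ×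
    (∀ w′ → IsPerturbation γ w w′ → IsUniqueMaximum w′ I*)

  LPFeasible : (Fin n → Carrier) → Set ℓ₃
  LPFeasible x =
    (∀ u v → u ~ v → x u + x v ≤ 1#) × (∀ u → 0# ≤ x u × x u ≤ 1#)

  LPValue : (w x : Fin n → Carrier) → Carrier
  LPValue w x = ∑ λ u → w u * x u

  LPOptimal : (w x : Fin n → Carrier) → Set (c ⊔ ℓ₃)
  LPOptimal w x =
    LPFeasible x × (∀ y → LPFeasible y → LPValue w y ≤ LPValue w x)

  HalfIntegral : (Fin n → Carrier) → Set ℓ₁
  HalfIntegral x = ∀ u → x u ≈ 0# ⊎ x u ≈ ½ ⊎ x u ≈ 1#

  Integral : (Fin n → Carrier) → Set ℓ₁
  Integral x = ∀ u → x u ≈ 0# ⊎ x u ≈ 1#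

  indicator : Subset n → Fin n → Carrier
  indicator I u = if lookup I u then 1# else 0#

{-# OPTIONS --safe #-}

-- Let m = k − 1 and let w′ be w on I* and m w off I*: the perturbation most
-- hostile to I*.  For each colour j the set I_j of the vertices with x = 1,
-- together with those of colour j with x = ½, is independent.  A vertex with
-- x = ½ lies in one I_j out of k, so comparing vertex by vertex yields
--
--   k w′(I*) + 2m w(x) ≤ ∑_j w′(I_j) + 2m w(1_{I*}),
--
-- and w(1_{I*}) ≤ w(x) by LP optimality, so k w′(I*) ≤ ∑_j w′(I_j).  As
-- w′(I_j) ≤ w′(I*) for each j, every I_j has maximum w′-weight, hence I_j = I*
-- by stability.  Since k ≥ 2, a vertex with x = ½ would lie in some I_j but
-- not in all of them.
module Submission where

open import Defs
open import Algebra.Bundles using (CommutativeRing)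
open import Data.Bool using (Bool; true; false; if_then_else_)
open import Data.Fin using (Fin; zero; suc; punchIn; _≟_)
open import Data.Fin.Properties using (punchInᵢ≢i)
open import Data.Fin.Subset using (Subset; _∈_)
open import Data.Nat using (ℕ; zero; suc) renaming (_≤_ to _≤ℕ_; z≤n to z≤ℕn; s≤s to s≤ℕs)
open import Data.Product using (_×_; ∃; _,_; proj₁; proj₂)
open import Data.Sum using (_⊎_; inj₁; inj₂; [_,_])
open import Data.Vec using (lookup; tabulate)
open import Data.Vec.Properties using (lookup∘tabulate; []=⇒lookup; lookup⇒[]=)
open import Function using (_∘_)
open import Function.Bundles using (module Equivalence)
open import Relation.Binary.Bundles using (Poset)
open import Relation.Binary.PropositionalEquality as ≡ using (_≡_)
open import Relation.Binary.Structures using (IsPartialOrder)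
open import Relation.Nullary using (¬_; does; yes; contradiction)
open import Relation.Nullary.Decidable using (dec-true; dec-false)
import Algebra.Definitions.RawMonoid as RawMonoidDefs
import Algebra.Properties.CommutativeMonoid.Mult as CommutativeMonoidMult
import Algebra.Properties.CommutativeMonoid.Sum as Sum
import Algebra.Properties.Semiring.Mult as SemiringMult
import Relation.Binary.Reasoning.PartialOrder as PartialOrderReasoning

-- Order, natural multiples and sums in an ordered field.

module OrderedFieldProperties {c ℓ₁ ℓ₂ ℓ₃} (F : OrderedField c ℓ₁ ℓ₂ ℓ₃) where

  open OrderedField F hiding (zero)
  open CommutativeRing commutativeRing public using (semiring)
  open Sum +-commutativeMonoid using (∑-comm; ∑-distrib-+; sum-replicate; sum-replicate-zero)
  open SemiringMult semiring using (×-assoc-*; ×-congʳ)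

  infixr 8 _·_
  _·_ : ℕ → Carrier → Carrier
  _·_ = RawMonoidDefs._×_ +-rawMonoid

  <⇒≤ : ∀ {x y} → x < y → x ≤ y
  <⇒≤ x<y y<x = <-irrefl refl (<-trans x<y y<x)

  -- Substitute for totality of the order: apartness of `x` and `z` is cotransitive, and where `y`
  -- turns out to lie outside the interval, transitivity with `x < z` gives the other alternative.
  <-cotrans : ∀ {x z} → x < z → ∀ y → x < y ⊎ y < z
  <-cotrans x<z y with #-cotrans (Equivalence.from #⇔<⊎> (inj₁ x<z)) y
  <-cotrans x<z y | inj₁ x#y with Equivalence.to #⇔<⊎> x#y
  ... | inj₁ x<y = inj₁ x<y
  ... | inj₂ y<x = inj₂ (<-trans y<x x<z)
  <-cotrans x<z y | inj₂ y#z with Equivalence.to #⇔<⊎> y#z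
  ... | inj₁ y<z = inj₂ y<z
  ... | inj₂ z<y = inj₁ (<-trans x<z z<y)

  -- As `≤` is the negation of the reversed `<`, its transitivity comes from cotransitivity of `<`
  -- and its antisymmetry from tightness of apartness.
  ≤-isPartialOrder : IsPartialOrder _≈_ _≤_
  ≤-isPartialOrder = record
    { isPreorder = record
      { isEquivalence = isEquivalence
      ; reflexive     = λ x≈y → <-irrefl (sym x≈y)
      ; trans         = λ {_} {y} x≤y y≤z z<x → [ y≤z , x≤y ] (<-cotrans z<x y)
      }
    ; antisym = λ {x} {y} x≤y y≤x →
        proj₁ (tight x y) ([ y≤x , x≤y ] ∘ Equivalence.to #⇔<⊎>)
    }

  ≤-poset : Poset c ℓ₁ ℓ₃
  ≤-poset = record { isPartialOrder = ≤-isPartialOrder }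

  open Poset ≤-poset public
    using () renaming (refl to ≤-refl; trans to ≤-trans; reflexive to ≤-reflexive)
  open PartialOrderReasoning ≤-poset

  +-cancelʳ-< : ∀ {x y} z → x + z < y + z → x < y
  +-cancelʳ-< {x} {y} z x+z<y+z =
    <-respˡ-≈ (+-cancel-‿ x) (<-respʳ-≈ (+-cancel-‿ y) (+-monoˡ-< (- z) x+z<y+z))
    where
    +-cancel-‿ : ∀ t → t + z - z ≈ t
    +-cancel-‿ t = trans (+-assoc t z (- z)) (trans (+-congˡ (-‿inverseʳ z)) (+-identityʳ t))

  +-cancelʳ-≤ : ∀ {x y} z → x + z ≤ y + z → x ≤ y
  +-cancelʳ-≤ z x+z≤y+z y<x = x+z≤y+z (+-monoˡ-< z y<x)

  +-monoˡ-≤ : ∀ {x y} z → x ≤ y → x + z ≤ y + z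
  +-monoˡ-≤ z x≤y y+z<x+z = x≤y (+-cancelʳ-< z y+z<x+z)

  +-mono-≤ : ∀ {x y z t} → x ≤ y → z ≤ t → x + z ≤ y + t
  +-mono-≤ {x} {y} {z} {t} x≤y z≤t = begin
    x + z ≤⟨ +-monoˡ-≤ z x≤y ⟩
    y + z ≈⟨ +-comm y z ⟩
    z + y ≤⟨ +-monoˡ-≤ y z≤t ⟩
    t + y ≈⟨ +-comm t y ⟩
    y + t ∎

  x≤x+y : ∀ {x y} → 0# ≤ y → x ≤ x + y
  x≤x+y {x} {y} 0≤y = begin
    x      ≈⟨ +-identityʳ x ⟨
    x + 0# ≤⟨ +-mono-≤ ≤-refl 0≤y ⟩
    x + y  ∎

  x<y+x : ∀ {x y} → 0# < y → x < y + x
  x<y+x {x} 0<y = <-respˡ-≈ (+-identityˡ x) (+-monoˡ-< x 0<y)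

  -- Cotransitivity places `½` against `0 < 1`. In the case `½ < 1`, which reads `0 + ½ < ½ + ½`,
  -- one `½` cancels.
  0<½ : 0# < ½
  0<½ with <-cotrans 0<1 ½
  ... | inj₁ 0<½ = 0<½
  ... | inj₂ ½<1 = +-cancelʳ-< ½ (<-respˡ-≈ (sym (+-identityˡ ½)) (<-respʳ-≈ (sym ½+½≈1) ½<1))

  ·-mono-≤ : ∀ m {x y} → x ≤ y → m · x ≤ m · y
  ·-mono-≤ zero    x≤y = ≤-refl
  ·-mono-≤ (suc m) x≤y = +-mono-≤ x≤y (·-mono-≤ m x≤y)

  ·-nonNeg : ∀ m {x} → 0# ≤ x → 0# ≤ m · x
  ·-nonNeg zero    0≤x = ≤-refl
  ·-nonNeg (suc m) 0≤x = ≤-trans 0≤x (x≤x+y (·-nonNeg m 0≤x))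

  ·-zeroʳ : ∀ m → m · 0# ≈ 0#
  ·-zeroʳ zero    = refl
  ·-zeroʳ (suc m) = trans (+-identityˡ _) (·-zeroʳ m)

  -- Turns the stability factor `k − 1` into an `m`-fold sum, so that the estimates need only
  -- natural multiples.
  fromℕ-1-* : ∀ m x → (fromℕ (suc m) - 1#) * x ≈ m · x
  fromℕ-1-* m x = begin-equality
    (1# + fromℕ m - 1#) * x   ≈⟨ *-congʳ (+-congʳ (+-comm 1# (fromℕ m))) ⟩
    (fromℕ m + 1# - 1#) * x   ≈⟨ *-congʳ (+-assoc (fromℕ m) 1# (- 1#)) ⟩
    (fromℕ m + (1# - 1#)) * x ≈⟨ *-congʳ (+-congˡ (-‿inverseʳ 1#)) ⟩
    (fromℕ m + 0#) * x        ≈⟨ *-congʳ (+-identityʳ (fromℕ m)) ⟩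
    fromℕ m * x               ≈⟨ ×-assoc-* m 1# x ⟩
    m · (1# * x)              ≈⟨ ×-congʳ m (*-identityˡ x) ⟩
    m · x                     ∎

  -- Finite sums.

  ∑-mono-≤ : ∀ {n} {f g : Fin n → Carrier} → (∀ i → f i ≤ g i) → ∑ f ≤ ∑ g
  ∑-mono-≤ {zero}  f≤g = ≤-refl
  ∑-mono-≤ {suc n} f≤g = +-mono-≤ (f≤g zero) (∑-mono-≤ (f≤g ∘ suc))

  -- All terms but one are bounded by `f≤g` and cancel, which leaves the reverse inequality at the
  -- remaining index.
  ∑-≤⇒pointwise-≥ : ∀ {n} {f g : Fin n → Carrier} →
                    (∀ i → f i ≤ g i) → ∑ g ≤ ∑ f → ∀ i → g i ≤ f i
  ∑-≤⇒pointwise-≥ {suc n} {f} {g} f≤g ∑g≤∑f zero = +-cancelʳ-≤ (∑ (g ∘ suc)) (begin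
    ∑ g                       ≤⟨ ∑g≤∑f ⟩
    f zero + ∑ (f ∘ suc)      ≤⟨ +-mono-≤ ≤-refl (∑-mono-≤ (f≤g ∘ suc)) ⟩
    f zero + ∑ (g ∘ suc)      ∎)
  ∑-≤⇒pointwise-≥ {suc n} {f} {g} f≤g ∑g≤∑f (suc i) =
    ∑-≤⇒pointwise-≥ (f≤g ∘ suc) (+-cancelʳ-≤ (g zero) (begin
      ∑ (g ∘ suc) + g zero    ≈⟨ +-comm _ _ ⟩
      ∑ g                     ≤⟨ ∑g≤∑f ⟩
      f zero + ∑ (f ∘ suc)    ≤⟨ +-monoˡ-≤ _ (f≤g zero) ⟩
      g zero + ∑ (f ∘ suc)    ≈⟨ +-comm _ _ ⟩
      ∑ (f ∘ suc) + g zero    ∎)) i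

  ∑-const : ∀ n {x} → ∑ {n} (λ _ → x) ≈ n · x
  ∑-const n = sum-replicate n

  ∑-zero : ∀ n → ∑ {n} (λ _ → 0#) ≈ 0#
  ∑-zero = sum-replicate-zero

  ∑-· : ∀ {n} m (f : Fin n → Carrier) → ∑ (λ i → m · f i) ≈ m · ∑ f
  ∑-· {n} zero f = ∑-zero n
  ∑-· (suc m) f = trans (∑-distrib-+ f _) (+-congˡ (∑-· m f))

  ∑-indicator : ∀ {n} (i : Fin n) x → ∑ (λ j → if does (i ≟ j) then x else 0#) ≈ x
  ∑-indicator {suc n} zero    x = trans (+-congˡ (∑-zero n)) (+-identityʳ x)
  ∑-indicator {suc n} (suc i) x = trans (+-identityˡ _) (∑-indicator i x)

  -- Exchanges the sums over vertices and colours: inequalities at single vertices add up to one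
  -- between the weights of whole sets.
  ∑-∑+·2 : ∀ {k n} m (f : Fin k → Fin n → Carrier) (g : Fin n → Carrier) →
           ∑ (λ u → ∑ (λ j → f j u) + m · (g u + g u)) ≈ ∑ (λ j → ∑ (f j)) + m · (∑ g + ∑ g)
  ∑-∑+·2 m f g = begin-equality
    ∑ (λ u → ∑ (λ j → f j u) + m · (g u + g u))
      ≈⟨ ∑-distrib-+ (λ u → ∑ (λ j → f j u)) (λ u → m · (g u + g u)) ⟩
    ∑ (λ u → ∑ (λ j → f j u)) + ∑ (λ u → m · (g u + g u))
      ≈⟨ +-cong (∑-comm (λ u j → f j u)) (∑-· m (λ u → g u + g u)) ⟩
    ∑ (λ j → ∑ (f j)) + m · ∑ (λ u → g u + g u)
      ≈⟨ +-congˡ (×-congʳ m (∑-distrib-+ g g)) ⟩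
    ∑ (λ j → ∑ (f j)) + m · (∑ g + ∑ g) ∎

-- Rounding by colour, first at a single vertex.

module Rounding {c ℓ₁ ℓ₂ ℓ₃} (F : OrderedField c ℓ₁ ℓ₂ ℓ₃) (l : ℕ) where

  open OrderedField F hiding (zero)
  open OrderedFieldProperties F
  open CommutativeMonoidMult +-commutativeMonoid using (×-distrib-+; ×-congʳ)
  open Sum +-commutativeMonoid using (sum-cong-≗)
  open PartialOrderReasoning ≤-poset

  -- Writing `k` as `l + 2` builds in `k ≥ 2`: thus `m ≥ 1`, and every colour has another one beside
  -- it.
  m k : ℕ
  m = suc l
  k = suc m

  HalfInteger : Carrier → Set ℓ₁
  HalfInteger a = a ≈ 0# ⊎ a ≈ ½ ⊎ a ≈ 1#

  -- Decides whether a vertex of value `a` and colour `i` belongs to the set of colour `j`. The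
  -- choice is read off the half-integrality witness, since equality of scalars is not decidable.
  selected : ∀ {a} → HalfInteger a → Fin k → Fin k → Bool
  selected (inj₁ _)        i j = false
  selected (inj₂ (inj₁ _)) i j = does (i ≟ j)
  selected (inj₂ (inj₂ _)) i j = true

  selected⁻¹ : ∀ {a} (h : HalfInteger a) {i j : Fin k} → selected h i j ≡ true →
               a ≈ 1# ⊎ (a ≈ ½ × i ≡ j)
  selected⁻¹ (inj₂ (inj₁ a≈½)) {i} {j} eq with i ≟ j
  ... | yes i≡j = inj₂ (a≈½ , i≡j)
  selected⁻¹ (inj₂ (inj₂ a≈1)) eq = inj₁ a≈1

  -- A vertex of value `½` is selected for its own colour and for no other, so its selection cannot
  -- be constant in `j`.
  constant⇒integer : ∀ {a} (h : HalfInteger a) (i : Fin k) b → (∀ j → selected h i j ≡ b) →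
                     a ≈ (if b then 1# else 0#)
  constant⇒integer (inj₁ a≈0)        i b constant rewrite ≡.sym (constant i) = a≈0
  constant⇒integer (inj₂ (inj₂ a≈1)) i b constant rewrite ≡.sym (constant i) = a≈1
  constant⇒integer (inj₂ (inj₁ _))   i b constant = contradiction true≡false λ ()
    where
    -- Some colour other than `i`.
    j = punchIn i zero
    true≡false : true ≡ false
    true≡false = ≡.trans (≡.sym (dec-true (i ≟ i) ≡.refl))
      (≡.trans (constant i) (≡.trans (≡.sym (constant j))
        (dec-false (i ≟ j) (punchInᵢ≢i i zero ∘ ≡.sym))))

  hostile : Bool → Carrier → Carrier
  hostile b w = if b then w else m · w

  module _ {w : Carrier} (0<w : 0# < w) where

    w≤m·w : w ≤ m · w
    w≤m·w = x≤x+y (·-nonNeg l (<⇒≤ 0<w))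

    w≤hostile : ∀ b → w ≤ hostile b w
    w≤hostile true  = ≤-refl
    w≤hostile false = w≤m·w

    hostile≤m·w : ∀ b → hostile b w ≤ m · w
    hostile≤m·w true  = w≤m·w
    hostile≤m·w false = ≤-refl

  -- The coefficient is `2m`, not 2; in this form the value `½` contributes exactly `m · w`.
  double : Carrier → Carrier
  double x = m · (x + x)

  double-cong : ∀ {x y} → x ≈ y → double x ≈ double y
  double-cong x≈y = ×-congʳ m (+-cong x≈y x≈y)

  double-0 : ∀ w → double (w * 0#) ≈ 0#
  double-0 w = trans (double-cong (zeroʳ w)) (trans (×-congʳ m (+-identityˡ 0#)) (·-zeroʳ m))

  double-½ : ∀ w → double (w * ½) ≈ m · w
  double-½ w = ×-congʳ m (trans (sym (distribˡ w ½ ½)) (trans (*-congˡ ½+½≈1) (*-identityʳ w)))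

  double-1 : ∀ w → double (w * 1#) ≈ m · w + m · w
  double-1 w = trans (double-cong (*-identityʳ w)) (×-distrib-+ w w m)

  -- The contribution of one vertex, where `b` tells whether it lies in the stable set. Both sides
  -- agree except in two cases: inside with value 0, where `w ≤ m · w` is used, and outside with
  -- value 1, where `2 ≤ k` is.
  rounding-≤ : ∀ b {a w} (h : HalfInteger a) (i : Fin k) → 0# < w →
    ∑ {k} (λ j → if b then hostile b w else 0#) + m · (w * a + w * a) ≤
    ∑ {k} (λ j → if selected h i j then hostile b w else 0#)
      + m · (w * (if b then 1# else 0#) + w * (if b then 1# else 0#))
  rounding-≤ true {a} {w} (inj₁ a≈0) i 0<w = begin
    ∑ {k} (λ j → w) + double (w * a)
      ≈⟨ +-cong (∑-const k) (trans (double-cong (*-congˡ a≈0)) (double-0 w)) ⟩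
    w + m · w + 0#                            ≈⟨ +-identityʳ _ ⟩
    w + m · w                                 ≤⟨ +-monoˡ-≤ _ (w≤m·w 0<w) ⟩
    m · w + m · w                             ≈⟨ double-1 w ⟨
    double (w * 1#)                         ≈⟨ +-identityˡ _ ⟨
    0# + double (w * 1#)                    ≈⟨ +-congʳ (∑-zero k) ⟨
    ∑ {k} (λ j → 0#) + double (w * 1#)      ∎
  rounding-≤ true {a} {w} (inj₂ (inj₁ a≈½)) i 0<w = begin
    ∑ {k} (λ j → w) + double (w * a)
      ≈⟨ +-cong (∑-const k) (trans (double-cong (*-congˡ a≈½)) (double-½ w)) ⟩
    w + m · w + m · w                         ≈⟨ +-assoc _ _ _ ⟩
    w + (m · w + m · w)                       ≈⟨ +-cong (∑-indicator i w) (double-1 w) ⟨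
    ∑ (λ j → if does (i ≟ j) then w else 0#) + double (w * 1#) ∎
  rounding-≤ true {a} {w} (inj₂ (inj₂ a≈1)) i 0<w =
    ≤-reflexive (+-congˡ (double-cong (*-congˡ a≈1)))
  rounding-≤ false {a} {w} (inj₁ a≈0) i 0<w =
    ≤-reflexive (+-congˡ (double-cong (*-congˡ a≈0)))
  rounding-≤ false {a} {w} (inj₂ (inj₁ a≈½)) i 0<w = begin
    ∑ {k} (λ j → 0#) + double (w * a)
      ≈⟨ +-cong (∑-zero k) (trans (double-cong (*-congˡ a≈½)) (double-½ w)) ⟩
    0# + m · w                                ≈⟨ +-comm _ _ ⟩
    m · w + 0#                                ≈⟨ +-cong (∑-indicator i (m · w)) (double-0 w) ⟨
    ∑ (λ j → if does (i ≟ j) then m · w else 0#) + double (w * 0#) ∎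
  rounding-≤ false {a} {w} (inj₂ (inj₂ a≈1)) i 0<w = begin
    ∑ {k} (λ j → 0#) + double (w * a)
      ≈⟨ +-cong (∑-zero k) (trans (double-cong (*-congˡ a≈1)) (double-1 w)) ⟩
    0# + (m · w + m · w)                      ≈⟨ +-identityˡ _ ⟩
    m · w + m · w
      -- Of the `k = 2 + l` copies of `m · w`, the last `l` are nonnegative.
      ≤⟨ +-mono-≤ ≤-refl (x≤x+y (·-nonNeg l (·-nonNeg m (<⇒≤ 0<w)))) ⟩
    k · (m · w)                               ≈⟨ +-identityʳ _ ⟨
    k · (m · w) + 0#                          ≈⟨ +-cong (∑-const k) (double-0 w) ⟨
    ∑ {k} (λ j → m · w) + double (w * 0#)   ∎

  ½or1+1≰1 : ∀ {a b} → a ≈ 1# ⊎ a ≈ ½ → b ≈ 1# → ¬ (a + b ≤ 1#)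
  ½or1+1≰1 {a} a≈ b≈1 a+b≤1 =
    a+b≤1 (<-respʳ-≈ (+-congˡ (sym b≈1)) (x<y+x (0<a a≈)))
    where
    0<a : a ≈ 1# ⊎ a ≈ ½ → 0# < a
    0<a (inj₁ a≈1) = <-respʳ-≈ (sym a≈1) 0<1
    0<a (inj₂ a≈½) = <-respʳ-≈ (sym a≈½) 0<½

  -- The rounded sets in a coloured graph.

  module _ {n : ℕ} (G : Graph n) (colorable : Colorable G k) where

    open Graph G
    open MIS F G

    indicator-feasible : ∀ {I} → Independent G I → LPFeasible (indicator I)
    indicator-feasible {I} independent = edge , λ u → bounds (lookup I u)
      where
      bounds : ∀ b → 0# ≤ (if b then 1# else 0#) × (if b then 1# else 0#) ≤ 1#
      bounds true  = <⇒≤ 0<1 , ≤-refl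
      bounds false = ≤-refl , <⇒≤ 0<1
      edge : ∀ u v → u ~ v → indicator I u + indicator I v ≤ 1#
      edge u v u~v with lookup I u in u∈I | lookup I v in v∈I
      ... | true  | true  = contradiction u~v
        (independent u v (lookup⇒[]= u I u∈I) (lookup⇒[]= v I v∈I))
      ... | true  | false = ≤-reflexive (+-identityʳ 1#)
      ... | false | b     = ≤-trans (≤-reflexive (+-identityˡ _)) (proj₂ (bounds b))

    col = proj₁ colorable

    module _ {x : Fin n → Carrier} (half : HalfIntegral x) where

      rounding : Fin k → Subset n
      rounding j = tabulate λ u → selected (half u) (col u) j

      lookup-rounding : ∀ j u → lookup (rounding j) u ≡ selected (half u) (col u) j
      lookup-rounding j = lookup∘tabulate (λ u → selected (half u) (col u) j)

      weight-rounding : ∀ w j → weight w (rounding j) ≡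
                        ∑ (λ u → if selected (half u) (col u) j then w u else 0#)
      weight-rounding w j = sum-cong-≗ λ u →
        ≡.cong (if_then w u else 0#) (lookup-rounding j u)

      -- Of two adjacent selected vertices, either one has value 1 and the other at least `½`, which
      -- violates the edge constraint, or both have value `½` and share the colour `j`, which
      -- violates the colouring.
      rounding-independent : LPFeasible x → ∀ j → Independent G (rounding j)
      rounding-independent (edge , _) j u v u∈ v∈ u~v
        with selected⁻¹ (half u) (member u u∈) | selected⁻¹ (half v) (member v v∈)
        where
        member : ∀ u → u ∈ rounding j → selected (half u) (col u) j ≡ true
        member u u∈ = ≡.trans (≡.sym (lookup-rounding j u)) ([]=⇒lookup u∈)
      ... | inj₁ xu≈1         | inj₁ xv≈1         = ½or1+1≰1 (inj₁ xu≈1) xv≈1 (edge u v u~v)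
      ... | inj₁ xu≈1         | inj₂ (xv≈½ , _)   = ½or1+1≰1 (inj₂ xv≈½) xu≈1 (edge v u (~-sym u~v))
      ... | inj₂ (xu≈½ , _)   | inj₁ xv≈1         = ½or1+1≰1 (inj₂ xu≈½) xv≈1 (edge u v u~v)
      ... | inj₂ (_ , cu≡j)   | inj₂ (_ , cv≡j)   =
        proj₂ colorable u v u~v (≡.trans cu≡j (≡.sym cv≡j))

      -- Comparison of weights under the hostile perturbation.

      module _ {w : Fin n → Carrier} (0<w : ∀ u → 0# < w u) where

        perturbed : Subset n → Fin n → Carrier
        perturbed I u = hostile (lookup I u) (w u)

        perturbed-isPerturbation : ∀ I → IsPerturbation (fromℕ k - 1#) w (perturbed I)
        perturbed-isPerturbation I u =
          w≤hostile (0<w u) (lookup I u) ,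
          ≤-trans (hostile≤m·w (0<w u) (lookup I u)) (≤-reflexive (sym (fromℕ-1-* m (w u))))

        -- The vertex inequalities are summed with the LP terms kept on both sides; optimality of
        -- `x` then allows these terms to be cancelled.
        ∑-weight-≤ : LPOptimal w x → ∀ {I} → Independent G I →
          ∑ {k} (λ j → weight (perturbed I) I) ≤ ∑ (λ j → weight (perturbed I) (rounding j))
        ∑-weight-≤ (_ , optimal) {I} independent = +-cancelʳ-≤ (double (LPValue w x)) (begin
          ∑ {k} (λ j → weight w′ I) + double (LPValue w x)
            ≈⟨ ∑-∑+·2 {k} m (λ j u → if lookup I u then w′ u else 0#) (λ u → w u * x u) ⟨
          ∑ (λ u → ∑ {k} (λ j → if lookup I u then w′ u else 0#) + double (w u * x u))
            ≤⟨ ∑-mono-≤ (λ u → rounding-≤ (lookup I u) (half u) (col u) (0<w u)) ⟩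
          ∑ (λ u → ∑ (λ j → if selected (half u) (col u) j then w′ u else 0#)
                   + double (w u * indicator I u))
            ≈⟨ ∑-∑+·2 m (λ j u → if selected (half u) (col u) j then w′ u else 0#)
                 (λ u → w u * indicator I u) ⟩
          ∑ (λ j → ∑ (λ u → if selected (half u) (col u) j then w′ u else 0#))
            + double (LPValue w (indicator I))
            ≡⟨ ≡.cong (_+ double (LPValue w (indicator I))) (sum-cong-≗ {k} (weight-rounding w′)) ⟨
          ∑ (λ j → weight w′ (rounding j)) + double (LPValue w (indicator I))
            -- The indicator of `I` competes with `x` in the LP.
            ≤⟨ +-mono-≤ ≤-refl (·-mono-≤ m (+-mono-≤ LP-≤ LP-≤)) ⟩
          ∑ (λ j → weight w′ (rounding j)) + double (LPValue w x) ∎)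
          where
          w′ = perturbed I
          LP-≤ = optimal (indicator I) (indicator-feasible independent)

        -- The rounded sets reach the maximum perturbed weight on average and none exceeds it, so
        -- each attains it and uniqueness applies.
        rounding-≡ : LPOptimal w x → (stable : Stable (fromℕ k - 1#) w) →
                     ∀ j → rounding j ≡ proj₁ stable
        rounding-≡ optimal (I , _ , stable) j =
          unique (rounding j) (independent j , λ J indJ → ≤-trans (maximal J indJ) (w′I≤ j))
          where
          w′I-unique = stable (perturbed I) (perturbed-isPerturbation I)
          unique = proj₂ w′I-unique
          maximal = proj₂ (proj₁ w′I-unique)
          independent = rounding-independent (proj₁ optimal)
          w′I≤ = ∑-≤⇒pointwise-≥ (λ j → maximal (rounding j) (independent j))
                   (∑-weight-≤ optimal (proj₁ (proj₁ w′I-unique)))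

        -- All rounded sets coincide with the stable set, so the selection of `u` does not depend on
        -- the colour `j`.
        x≈indicator : LPOptimal w x → (stable : Stable (fromℕ k - 1#) w) →
                      ∀ u → x u ≈ indicator (proj₁ stable) u
        x≈indicator optimal stable u = constant⇒integer (half u) (col u) _ λ j →
          ≡.trans (≡.sym (lookup-rounding j u))
            (≡.cong (λ I → lookup I u) (rounding-≡ optimal stable j))

mainTheorem2 : ∀ {c ℓ₁ ℓ₂ ℓ₃} (F : OrderedField c ℓ₁ ℓ₂ ℓ₃) →
    let open OrderedField F in
    (k : ℕ) → 2 ≤ℕ k →
    (n : ℕ) (G : Graph n) → Colorable G k →
    let open MIS F G in
    (w : Fin n → Carrier) → (∀ u → 0# < w u) →
    Stable (fromℕ k - 1#) w →
    (x : Fin n → Carrier) → LPOptimal w x → HalfIntegral x →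
    Integral x × (∃ λ I → IsUniqueMaximum w I × (∀ u → x u ≈ indicator I u))
mainTheorem2 F (suc (suc l)) (s≤ℕs (s≤ℕs z≤ℕn)) n G colorable w 0<w stable@(I , isMaximum , _) x optimal half =
  integral , I , isMaximum , x≈1I
  where
  open MIS F G
  open Rounding F l

  x≈1I = x≈indicator G colorable half 0<w optimal stable

  integral : Integral x
  integral u with lookup I u | x≈1I u
  ... | true  | x≈1 = inj₂ x≈1
  ... | false | x≈0 = inj₁ x≈0
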